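{- Let $L$ be a first-order language, let $\{\mathcal{A}_\lambda : \lambda \in \Lambda\}$ be a family of $L$-structures, and let $\mathcal{A} = \prod_{\lambda\in\Lambda}\mathcal{A}_\lambda$ be the direct product. Consider the following conditions. (A) The two-element Boolean algebra $\{0,1\}$ is uniformly interpretable in the structures $\mathcal{A}_\lambda$ via positive primitive $L$-formulae $\Theta_{\mathcal{B}}, \Theta_=, \Theta_0, \Theta_1, \Theta_\triangle, \Theta_\triangledown, \Theta_C$; and moreover for every atomic $L$-formula $\phi(\bar{x})$ the formula $\Theta_0(\bar{y}) \vee \phi(\bar{x})$ is uniformly equivalent in the structures $\mathcal{A}_\lambda$ to a positive primitive formula $\phi_0(\bar{x},\bar{y})$ (i.e. one and the same $\phi_0$ works for all $\lambda \in \Lambda$). (B) The Boolean algebra $\mathcal{P}(\Lambda)$ is interpretable in $\mathcal{A}$, by an interpretation in which $K_\phi$ is represented for every atomic $L$-formula $\phi$. (C) The Boolean algebra $\mathcal{P}(\Lambda)$ is interpretable in $\mathcal{A}$, by an interpretation in which $K_\varphi$ is represented for every $L$-formula $\varphi$. (D) The full generalized product of the family $\{\mathcal{A}_\lambda : \lambda\in\Lambda\}$ is definable in $\mathcal{A}$ (i.e. every relation $\mathcal{Q}_\xi^{\mathcal{A}}$ is definable in $\mathcal{A}$ by an $L$-formula), and the $L$-definable (without parameters) subsets of the finite powers $\mathcal{A}^n$ are exactly the sets $\mathcal{Q}_\xi^{\mathcal{A}}$ defined by acceptable sequences $\xi$. Then $(A) \Rightarrow (B)$, $(B) \iff (C)$,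 and $(C) \Rightarrow (D)$.
   Context: Direct product: $\prod_{\lambda}\mathcal{A}_\lambda$ has universe the Cartesian product; constants and functions are interpreted coordinatewise, and a relation symbol $R$ holds of $\bar{a}$ iff $\mathcal{A}_\lambda \models R(\bar{a}[\lambda])$ for every $\lambda \in\Lambda$. Here, for $\bar{a}=(a_1,\dots,a_n)$, $\bar{a}[\lambda] = (a_1(\lambda),\dots,a_n(\lambda))$. "$\bar a \in \mathcal{A}$" abbreviates $\bar{a}\in\mathcal{A}^n$ for the appropriate $n$. For a formula $\Theta$, $\Theta^{\mathcal{A}}$ is the set of tuples of $\mathcal{A}$ satisfying $\Theta$. $L_{Bool} = \{0,1,\triangledown,\triangle,{}^C\}$ is the language of Boolean algebras (join $\triangledown$, meet $\triangle$, complement ${}^C$); $\mathcal{P}(\Lambda)$ is the power set algebra with $0=\emptyset$, $1=\Lambda$, $\triangledown=\cup$, $\triangle=\cap$, ${}^C$ = complement in $\Lambda$. Positive primitive formula: a formula logically equivalent to one of the form $\exists \bar{y}\bigwedge \Phi$ with $\Phi$ a (finite) set of atomic formulae. Interpretation: a Boolean algebra $\mathcal{B}$ is interpretable in an $L$-structure $\mathcal{M}$ if there are $L$-formulae $\Theta_{\mathcal{B}}(\bar x), \Theta_=(\bar x,\bar y), \Theta_0(\bar x), \Theta_1(\bar x), \Theta_\triangle(\bar x,\bar y,\bar z), \Theta_\triangledown(\bar x,\bar y,\bar z), \Theta_C(\bar x,\bar y)$ (with $\bar x,\bar y,\bar z$ tuples of variables of one fixed length) and a surjection $F : (\Theta_{\mathcal{B}})^{\mathcal{M}}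 \to \mathcal{B}$ such that for all $\bar x,\bar y,\bar z\in (\Theta_{\mathcal{B}})^{\mathcal{M}}$: $F(\bar x)=F(\bar y)$ iff $\mathcal{M}\models\Theta_=(\bar x,\bar y)$; $F(\bar x)=0^{\mathcal{B}}$ iff $\mathcal{M}\models\Theta_0(\bar x)$; $F(\bar x)=1^{\mathcal{B}}$ iff $\mathcal{M}\models\Theta_1(\bar x)$; $F(\bar x)\triangle F(\bar y)=F(\bar z)$ iff $\mathcal{M}\models\Theta_\triangle(\bar x,\bar y,\bar z)$; $F(\bar x)\triangledown F(\bar y)=F(\bar z)$ iff $\mathcal{M}\models\Theta_\triangledown(\bar x,\bar y,\bar z)$; $F(\bar x)^C=F(\bar y)$ iff $\mathcal{M}\models\Theta_C(\bar x,\bar y)$. "Uniformly interpretable in the structures $\mathcal{A}_\lambda$" means that the same formulae serve for all $\lambda\in\Lambda$, with surjections $F_\lambda$. For an $L$-formula $\theta(\bar{x})$ and $\bar a\in\mathcal{A}$, $K_\theta(\bar{a}) := \{\lambda\in\Lambda : \mathcal{A}_\lambda\models\theta(\bar{a}[\lambda])\}$. Given an interpretation of $\mathcal{P}(\Lambda)$ in $\mathcal{A}$ by $(F,\Theta_{\mathcal{B}},\dots)$, $K_\theta$ is represented by an $L$-formula $\Upsilon_\theta(\bar{x},\bar{y})$ if for all $\bar{a}\in\mathcal{A}$ and $\bar{b}\in(\Theta_{\mathcal{B}})^{\mathcal{A}}$: $\mathcal{A}\models\Upsilon_\theta(\bar{a},\bar{b})$ iff $F(\bar{b})=K_\theta(\bar{a})$.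 $K_\theta$ is represented if it is represented by some $L$-formula. Acceptable sequence: $\xi=\langle\Phi;\theta_1,\dots,\theta_m\rangle$ with $\Phi$ an $L_{Bool}$-formula with free variables among $y_1,\dots,y_m$, and each $\theta_i$ an $L$-formula; the free variables of $\xi$ are those of $\theta_1,\dots,\theta_m$. For $\xi$ in free variables $x_1,\dots,x_n$, $\mathcal{Q}_\xi^{\mathcal{A}} := \{\bar{a}\in\mathcal{A}^n : \mathcal{P}(\Lambda)\models\Phi(K_{\theta_1}(\bar{a}),\dots,K_{\theta_m}(\bar{a}))\}$. The full generalized product of $\{\mathcal{A}_\lambda\}$ is the relational structure with the universe of $\prod_\lambda\mathcal{A}_\lambda$ and all relations $\mathcal{Q}_\xi^{\mathcal{A}}$. All formulae here are without parameters. -}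

module Defs where

open import Data.Bool.Base using (Bool; true; false; _∧_; _∨_; not)
open import Data.Empty.Polymorphic using (⊥)
open import Data.Fin.Base using (Fin; zero; suc)
open import Data.List.Base using (List; []; _∷_)
import Data.Empty as Empty
open import Data.Nat.Base using (ℕ; zero; suc; _+_)
open import Data.Product.Base using (∃; Σ-syntax; ∃-syntax; _×_; _,_; proj₁)
open import Data.Sum.Base as Sum using (_⊎_)
open import Data.Unit.Polymorphic using (⊤)
open import Data.Vec.Functional using (Vector; _++_) renaming ([] to []ᵛ; _∷_ to _∷ᵛ_)
open import Data.Vec.Functional.Relation.Binary.Pointwise using (Pointwise)
open import Function.Bundles using (_⇔_)
open import Function.Definitions using (StrictlySurjective)
open import Level using (Level; 0ℓ; Lift; lift; _⊔_) renaming (suc to lsuc)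
open import Relation.Binary.Core using (Rel)
open import Relation.Binary.PropositionalEquality using (_≡_; cong; cong₂; isEquivalence)
  renaming (refl to ≡-refl)
open import Relation.Binary.Structures using (IsEquivalence)
open import Relation.Nullary.Negation.Core using (¬_)
open import Relation.Unary using (Pred; _∪_; _∩_; ∁; _≐_)
open import Relation.Unary.Polymorphic using (∅; U)

private
  variable
    o b ℓ s : Level

-- Constant symbols are the function symbols of arity 0.
record Language (o : Level) : Set (lsuc o) where
  field
    FunSym : ℕ → Set o
    RelSym : ℕ → Set o

module _ (L : Language o) where
  open Language L

  infix  8 _≐′_
  infix  7 ¬′_
  infixr 6 _∧′_
  infixr 5 _∨′_
  infix  4 ∃′_ ∀′_

  data Term (n : ℕ) : Set o where
    var : Fin n → Term n
    app : ∀ {k} → FunSym k → Vector (Term n) k → Term n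

  data Atomic (n : ℕ) : Set o where
    _≐′_ : Term n → Term n → Atomic n
    rel  : ∀ {k} → RelSym k → Vector (Term n) k → Atomic n

  -- Formulae whose free variables are among n given ones.  The quantifiers
  -- bind variable zero (de Bruijn indices).
  data Formula (n : ℕ) : Set o where
    atom      : Atomic n → Formula n
    ⊤′ ⊥′     : Formula n
    ¬′_       : Formula n → Formula n
    _∧′_ _∨′_ : Formula n → Formula n → Formula n
    ∃′_ ∀′_   : Formula (suc n) → Formula n

-- Structures are nonempty.  The equality symbol is interpreted by an
-- equivalence relation compatible with all symbols, because a power set or
-- a product has the right notion of equality only extensionally; an
-- ordinary structure is the case where _≈_ is _≡_.
record Structure (L : Language o) (ℓ : Level) : Set (o ⊔ lsuc ℓ) where
  open Language L
  infix 4 _≈_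
  field
    Carrier       : Set ℓ
    inhabitant    : Carrier
    _≈_           : Rel Carrier ℓ
    ≈-equivalence : IsEquivalence _≈_
    fun           : ∀ {k} → FunSym k → Vector Carrier k → Carrier
    fun-cong      : ∀ {k} (f : FunSym k) {xs ys : Vector Carrier k} →
                    Pointwise _≈_ xs ys → fun f xs ≈ fun f ys
    holds         : ∀ {k} → RelSym k → Pred (Vector Carrier k) ℓ
    holds-resp    : ∀ {k} (R : RelSym k) {xs ys : Vector Carrier k} →
                    Pointwise _≈_ xs ys → holds R xs → holds R ys

open Structure public using (Carrier)

-- a̅ ∈ M
Tuple : {L : Language o} → Structure L ℓ → ℕ → Set ℓ
Tuple M n = Vector (Carrier M) n

module _ {L : Language o} where

  eval : ∀ (M : Structure L ℓ) {n} → Tuple M n → Term L n → Carrier M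
  eval M ρ (var i)    = ρ i
  eval M ρ (app f ts) = Structure.fun M f (λ i → eval M ρ (ts i))

  infix 3 _⊨ᵃ_[_] _⊨_[_]

  _⊨ᵃ_[_] : ∀ (M : Structure L ℓ) {n} → Atomic L n → Tuple M n → Set ℓ
  M ⊨ᵃ t ≐′ u   [ ρ ] = Structure._≈_ M (eval M ρ t) (eval M ρ u)
  M ⊨ᵃ rel R ts [ ρ ] = Structure.holds M R (λ i → eval M ρ (ts i))

  _⊨_[_] : ∀ (M : Structure L ℓ) {n} → Formula L n → Tuple M n → Set ℓ
  M ⊨ atom α [ ρ ] = M ⊨ᵃ α [ ρ ]
  M ⊨ ⊤′     [ ρ ] = ⊤
  M ⊨ ⊥′     [ ρ ] = ⊥
  M ⊨ ¬′ φ   [ ρ ] = ¬ (M ⊨ φ [ ρ ])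
  M ⊨ φ ∧′ ψ [ ρ ] = (M ⊨ φ [ ρ ]) × (M ⊨ ψ [ ρ ])
  M ⊨ φ ∨′ ψ [ ρ ] = (M ⊨ φ [ ρ ]) ⊎ (M ⊨ ψ [ ρ ])
  M ⊨ ∃′ φ   [ ρ ] = ∃ λ x → M ⊨ φ [ x ∷ᵛ ρ ]
  M ⊨ ∀′ φ   [ ρ ] = ∀ x → M ⊨ φ [ x ∷ᵛ ρ ]

  Definable : ∀ (M : Structure L ℓ) {n} → Pred (Tuple M n) s → Set (o ⊔ ℓ ⊔ s)
  Definable M {n} S = Σ[ ψ ∈ Formula L n ] S ≐ (λ a → M ⊨ ψ [ a ])

module _ {L : Language o} where

  ⋀ : ∀ {n} → List (Atomic L n) → Formula L n
  ⋀ []      = ⊤′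
  ⋀ (α ∷ Φ) = atom α ∧′ ⋀ Φ

  ∃⋆ : ∀ m {n} → Formula L (m + n) → Formula L n
  ∃⋆ zero    φ = φ
  ∃⋆ (suc m) φ = ∃⋆ m (∃′ φ)

  -- The level ℓ only bounds the size of the structures among which logical
  -- equivalence is tested; countable structures exist at every level, so by
  -- Löwenheim–Skolem the choice of ℓ is immaterial.
  LogicallyEquivalent : ∀ ℓ {n} → Rel (Formula L n) (o ⊔ lsuc ℓ)
  LogicallyEquivalent ℓ φ ψ =
    ∀ (M : Structure L ℓ) ρ → (M ⊨ φ [ ρ ]) ⇔ (M ⊨ ψ [ ρ ])

  PositivePrimitive : ∀ ℓ {n} → Pred (Formula L n) (o ⊔ lsuc ℓ)
  PositivePrimitive ℓ {n} φ =
    ∃[ m ] Σ[ Φ ∈ List (Atomic L (m + n)) ] LogicallyEquivalent ℓ φ (∃⋆ m (⋀ Φ))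

∏ : {L : Language o} {Λ : Set ℓ} → (Λ → Structure L ℓ) → Structure L ℓ
∏ {Λ = Λ} 𝒜 = record
  { Carrier       = ∀ i → Carrier (𝒜 i)
  ; inhabitant    = λ i → A.inhabitant i
  ; _≈_           = λ x y → ∀ i → A._≈_ i (x i) (y i)
  ; ≈-equivalence = record
    { refl  = λ i → IsEquivalence.refl (A.≈-equivalence i)
    ; sym   = λ p i → IsEquivalence.sym (A.≈-equivalence i) (p i)
    ; trans = λ p q i → IsEquivalence.trans (A.≈-equivalence i) (p i) (q i)
    }
  ; fun           = λ f xs i → A.fun i f (λ j → xs j i)
  ; fun-cong      = λ f p i → A.fun-cong i f (λ j → p j i)
  ; holds         = λ R xs → ∀ i → A.holds i R (λ j → xs j i)
  ; holds-resp    = λ R p h i → A.holds-resp i R (λ j → p j i) (h i)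
  }
  where module A (i : Λ) = Structure (𝒜 i)

module _ {L : Language o} {Λ : Set ℓ} (𝒜 : Λ → Structure L ℓ) where

  -- a̅[i]
  coord : ∀ {n} → Tuple (∏ 𝒜) n → (i : Λ) → Tuple (𝒜 i) n
  coord a i = λ j → a j i

  K : ∀ {n} → Formula L n → Tuple (∏ 𝒜) n → Pred Λ ℓ
  K θ a i = 𝒜 i ⊨ θ [ coord a i ]

data BoolSym : ℕ → Set where
  0ˢ 1ˢ : BoolSym 0
  ▽ˢ △ˢ : BoolSym 2
  Cˢ    : BoolSym 1

LBool : Language 0ℓ
LBool = record { FunSym = BoolSym ; RelSym = λ _ → Empty.⊥ }

module BoolOps (B : Structure LBool b) where
  open Structure B using (fun)

  𝟘 𝟙 : Carrier B
  𝟘 = fun 0ˢ []ᵛ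
  𝟙 = fun 1ˢ []ᵛ

  _▽_ _△_ : Carrier B → Carrier B → Carrier B
  x ▽ y = fun ▽ˢ (x ∷ᵛ y ∷ᵛ []ᵛ)
  x △ y = fun △ˢ (x ∷ᵛ y ∷ᵛ []ᵛ)

  _ᶜ : Carrier B → Carrier B
  x ᶜ = fun Cˢ (x ∷ᵛ []ᵛ)

𝟚 : Structure LBool 0ℓ
𝟚 = record
  { Carrier       = Bool
  ; inhabitant    = false
  ; _≈_           = _≡_
  ; ≈-equivalence = isEquivalence
  ; fun           = ⟦_⟧
  ; fun-cong      = ⟦_⟧-cong
  ; holds         = λ ()
  ; holds-resp    = λ ()
  }
  where
  ⟦_⟧ : ∀ {k} → BoolSym k → Vector Bool k → Bool
  ⟦ 0ˢ ⟧ x = false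
  ⟦ 1ˢ ⟧ x = true
  ⟦ ▽ˢ ⟧ x = x zero ∨ x (suc zero)
  ⟦ △ˢ ⟧ x = x zero ∧ x (suc zero)
  ⟦ Cˢ ⟧ x = not (x zero)

  ⟦_⟧-cong : ∀ {k} (f : BoolSym k) {x y : Vector Bool k} →
             Pointwise _≡_ x y → ⟦ f ⟧ x ≡ ⟦ f ⟧ y
  ⟦ 0ˢ ⟧-cong p = ≡-refl
  ⟦ 1ˢ ⟧-cong p = ≡-refl
  ⟦ ▽ˢ ⟧-cong p = cong₂ _∨_ (p zero) (p (suc zero))
  ⟦ △ˢ ⟧-cong p = cong₂ _∧_ (p zero) (p (suc zero))
  ⟦ Cˢ ⟧-cong p = cong not (p zero)

-- Subsets are predicates, equal when they have the same elements.
𝒫 : Set ℓ → Structure LBool (lsuc ℓ)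
𝒫 {ℓ} Λ = record
  { Carrier       = Pred Λ ℓ
  ; inhabitant    = ∅
  ; _≈_           = _∼_
  ; ≈-equivalence = record
    { refl  = lift ((λ x → x) , (λ x → x))
    ; sym   = λ (lift (p , q)) → lift (q , p)
    ; trans = λ (lift (p , q)) (lift (p′ , q′)) → lift ((λ x → p′ (p x)) , (λ x → q (q′ x)))
    }
  ; fun           = ⟦_⟧
  ; fun-cong      = ⟦_⟧-cong
  ; holds         = λ ()
  ; holds-resp    = λ ()
  }
  where
  _∼_ : Rel (Pred Λ ℓ) (lsuc ℓ)
  X ∼ Y = Lift (lsuc ℓ) (X ≐ Y)

  ⟦_⟧ : ∀ {k} → BoolSym k → Vector (Pred Λ ℓ) k → Pred Λ ℓ
  ⟦ 0ˢ ⟧ X = ∅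
  ⟦ 1ˢ ⟧ X = U
  ⟦ ▽ˢ ⟧ X = X zero ∪ X (suc zero)
  ⟦ △ˢ ⟧ X = X zero ∩ X (suc zero)
  ⟦ Cˢ ⟧ X = ∁ (X zero)

  ⟦_⟧-cong : ∀ {k} (f : BoolSym k) {X Y : Vector (Pred Λ ℓ) k} →
             Pointwise _∼_ X Y → ⟦ f ⟧ X ∼ ⟦ f ⟧ Y
  ⟦ 0ˢ ⟧-cong p = lift ((λ x → x) , (λ x → x))
  ⟦ 1ˢ ⟧-cong p = lift ((λ x → x) , (λ x → x))
  ⟦ ▽ˢ ⟧-cong p with p zero | p (suc zero)
  ... | lift (f , g) | lift (f′ , g′) = lift (Sum.map f f′ , Sum.map g g′)
  ⟦ △ˢ ⟧-cong p with p zero | p (suc zero)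
  ... | lift (f , g) | lift (f′ , g′) =
    lift ((λ (x , y) → f x , f′ y) , (λ (x , y) → g x , g′ y))
  ⟦ Cˢ ⟧-cong p with p zero
  ... | lift (f , g) = lift ((λ n x → n (g x)) , (λ n x → n (f x)))

-- k is the common length of the tuples x̅, y̅, z̅.
record InterpretingFormulae (L : Language o) (k : ℕ) : Set o where
  field
    Θ𝓑  : Formula L k
    Θ=  : Formula L (k + k)
    Θ0  : Formula L k
    Θ1  : Formula L k
    Θ△  : Formula L (k + (k + k))
    Θ▽  : Formula L (k + (k + k))
    ΘC  : Formula L (k + k)

-- F takes the proof that its argument satisfies Θ𝓑.  Its value does not
-- depend on that proof, nor on the choice of representatives modulo _≈_ of
-- M: this follows from =-iff, since satisfaction of Θ= depends on neither.
record Interpretation {L : Language o} {k : ℕ} (Θ : InterpretingFormulae L k)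
                      (B : Structure LBool b) (M : Structure L ℓ) : Set (b ⊔ ℓ) where
  open InterpretingFormulae Θ
  open Structure B using (_≈_)
  open BoolOps B

  Dom : Set ℓ
  Dom = ∃ λ (x : Tuple M k) → M ⊨ Θ𝓑 [ x ]

  field
    F            : Dom → Carrier B
    F-surjective : StrictlySurjective _≈_ F
    =-iff : ∀ (x y : Dom) →
            (F x ≈ F y) ⇔ (M ⊨ Θ= [ proj₁ x ++ proj₁ y ])
    0-iff : ∀ (x : Dom) → (F x ≈ 𝟘) ⇔ (M ⊨ Θ0 [ proj₁ x ])
    1-iff : ∀ (x : Dom) → (F x ≈ 𝟙) ⇔ (M ⊨ Θ1 [ proj₁ x ])
    △-iff : ∀ (x y z : Dom) →
            ((F x △ F y) ≈ F z) ⇔ (M ⊨ Θ△ [ proj₁ x ++ (proj₁ y ++ proj₁ z) ])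
    ▽-iff : ∀ (x y z : Dom) →
            ((F x ▽ F y) ≈ F z) ⇔ (M ⊨ Θ▽ [ proj₁ x ++ (proj₁ y ++ proj₁ z) ])
    C-iff : ∀ (x y : Dom) →
            ((F x ᶜ) ≈ F y) ⇔ (M ⊨ ΘC [ proj₁ x ++ proj₁ y ])

record AllPositivePrimitive {L : Language o} {k : ℕ} (ℓ : Level)
                            (Θ : InterpretingFormulae L k) : Set (o ⊔ lsuc ℓ) where
  open InterpretingFormulae Θ
  field
    Θ𝓑-pp : PositivePrimitive ℓ Θ𝓑
    Θ=-pp : PositivePrimitive ℓ Θ=
    Θ0-pp : PositivePrimitive ℓ Θ0
    Θ1-pp : PositivePrimitive ℓ Θ1
    Θ△-pp : PositivePrimitive ℓ Θ△
    Θ▽-pp : PositivePrimitive ℓ Θ▽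
    ΘC-pp : PositivePrimitive ℓ ΘC

-- ⟨ Φ ; θ₁ , … , θₘ ⟩ in the free variables x₁ , … , xₙ
record AcceptableSequence (L : Language o) (n : ℕ) : Set o where
  field
    m : ℕ
    Φ : Formula LBool m
    θ : Vector (Formula L n) m

module _ {L : Language o} {Λ : Set ℓ} (𝒜 : Λ → Structure L ℓ) where

  𝒬 : ∀ {n} → AcceptableSequence L n → Pred (Tuple (∏ 𝒜) n) (lsuc ℓ)
  𝒬 ξ a = 𝒫 Λ ⊨ Φ [ (λ i → K 𝒜 (θ i) a) ]
    where open AcceptableSequence ξ

  module _ {k : ℕ} {Θ : InterpretingFormulae L k}
           (I : Interpretation Θ (𝒫 Λ) (∏ 𝒜)) where
    open Interpretation I
    open Structure (𝒫 Λ) using (_≈_)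

    RepresentedBy : ∀ {n} → Formula L n → Formula L (n + k) → Set (lsuc ℓ)
    RepresentedBy θ Υ = ∀ a (b : Dom) →
      (∏ 𝒜 ⊨ Υ [ a ++ proj₁ b ]) ⇔ (F b ≈ K 𝒜 θ a)

    Represented : ∀ {n} → Formula L n → Set (o ⊔ lsuc ℓ)
    Represented θ = ∃ (RepresentedBy θ)

  ConditionA : Set (o ⊔ lsuc ℓ)
  ConditionA =
    ∃[ k ] Σ[ Θ ∈ InterpretingFormulae L k ]
      AllPositivePrimitive ℓ Θ
      × (∀ i → Interpretation Θ 𝟚 (𝒜 i))
      × (∀ n (φ : Atomic L n) →
           Σ[ φ₀ ∈ Formula L (n + k) ] PositivePrimitive ℓ φ₀
             × (∀ i (x : Tuple (𝒜 i) n) (y : Tuple (𝒜 i) k) →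
                  (𝒜 i ⊨ InterpretingFormulae.Θ0 Θ [ y ] ⊎ 𝒜 i ⊨ atom φ [ x ])
                    ⇔ (𝒜 i ⊨ φ₀ [ x ++ y ])))

  ConditionB : Set (o ⊔ lsuc ℓ)
  ConditionB =
    ∃[ k ] Σ[ Θ ∈ InterpretingFormulae L k ]
      Σ[ I ∈ Interpretation Θ (𝒫 Λ) (∏ 𝒜) ]
        (∀ n (φ : Atomic L n) → Represented I (atom φ))

  ConditionC : Set (o ⊔ lsuc ℓ)
  ConditionC =
    ∃[ k ] Σ[ Θ ∈ InterpretingFormulae L k ]
      Σ[ I ∈ Interpretation Θ (𝒫 Λ) (∏ 𝒜) ]
        (∀ n (φ : Formula L n) → Represented I φ)

  FullGeneralizedProductDefinable : Set (o ⊔ lsuc ℓ)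
  FullGeneralizedProductDefinable =
    ∀ n (ξ : AcceptableSequence L n) → Definable (∏ 𝒜) (𝒬 ξ)

  ConditionD : Set (o ⊔ lsuc (lsuc ℓ))
  ConditionD =
    FullGeneralizedProductDefinable
    × (∀ n (S : Pred (Tuple (∏ 𝒜) n) (lsuc ℓ)) →
         Definable (∏ 𝒜) S ⇔ (∃ λ (ξ : AcceptableSequence L n) → S ≐ 𝒬 ξ))

{-# OPTIONS --safe #-}
module Submission where

-- (A) ⇒ (B): a positive primitive formula holds in a product iff it holds in
-- every coordinate, so the interpretations of {0,1} glue to one of 𝒫(Λ), with
-- F(b) = { λ : F_λ(b[λ]) = 1 }.  The formula φ₀(a,b) then says F(b) ⊆ K_φ(a), and
-- K_φ(a) is represented as the greatest such F(b).
-- (B) ⇒ (C): the Boolean connectives are handled by the interpretation, and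
-- K_{∃xφ}(a) is the greatest of the sets K_φ(x,a), attained by choosing witnesses
-- in every coordinate.
-- (C) ⇒ (D): formulae over 𝒫(Λ) are translated through the interpretation;
-- conversely, every definable set is some 𝒬_ξ by the Feferman–Vaught theorem,
-- which holds in every direct product.

open import Defs
open import Axiom.ExcludedMiddle using (ExcludedMiddle)
open import Data.Bool.Base using (Bool; true; false; T; not)
open import Data.Bool.Properties using (T-∧; T-∨; T-≡; ⇔→≡)
open import Data.Empty.Polymorphic using (⊥-elim)
open import Data.Fin.Base using (Fin; zero; suc; _↑ˡ_; _↑ʳ_; splitAt; lift)
open import Data.List.Base using (List; []; _∷_)
open import Data.Nat.Base using (ℕ; zero; suc; _+_)
open import Data.Product.Base using (∃; Σ-syntax; ∃-syntax; _×_; _,_; proj₁; proj₂; map₂)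
open import Data.Product.Function.NonDependent.Propositional using (_×-⇔_)
open import Data.Sum.Base using (_⊎_; inj₁; inj₂; [_,_])
open import Data.Sum.Function.Propositional using (_⊎-⇔_)
open import Data.Vec.Functional using (Vector; _++_; map) renaming ([] to []ᵛ; _∷_ to _∷ᵛ_)
open import Data.Vec.Functional.Properties using (lookup-++ˡ; lookup-++ʳ)
open import Data.Vec.Functional.Relation.Binary.Pointwise using (Pointwise)
open import Data.Vec.Functional.Relation.Binary.Pointwise.Properties using (++⁺)
open import Function.Base using (_∘_; id)
open import Function.Bundles using (_⇔_; mk⇔; module Equivalence)
open import Function.Construct.Composition using (_⇔-∘_)
open import Function.Construct.Identity using (⇔-id)
open import Function.Construct.Symmetry using (⇔-sym)
open import Function.Related.TypeIsomorphisms using (¬-cong-⇔)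
open import Level using (Level; _⊔_; Lift; lower) renaming (suc to lsuc; lift to llift)
open import Relation.Binary.Core using (Rel)
open import Relation.Binary.PropositionalEquality
  using (_≡_; refl; sym; trans; subst; _≗_; cong)
open import Relation.Binary.Structures using (IsEquivalence)
open import Relation.Nullary.Decidable
  using (yes; no; ⌊_⌋; decidable-stable; fromWitness; map′; toWitness)
open import Relation.Nullary.Negation using (¬_; contradiction)
open import Relation.Unary using (Pred; _∈_; _⊆_; _≐_; _∩_)

open Equivalence using (to; from)

private
  variable
    o b ℓ r s p q : Level
    A B : Set p
    k m n : ℕ

-- Equivalences under quantifiers and maps over concatenations

∃-cong-⇔ : {P : A → Set p} {Q : A → Set q} → (∀ x → P x ⇔ Q x) → ∃ P ⇔ ∃ Q
∃-cong-⇔ e = mk⇔ (map₂ (to (e _))) (map₂ (from (e _)))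

Π-cong-⇔ : {P : A → Set p} {Q : A → Set q} → (∀ x → P x ⇔ Q x) → (∀ x → P x) ⇔ (∀ x → Q x)
Π-cong-⇔ e = mk⇔ (λ h x → to (e x) (h x)) (λ h x → from (e x) (h x))

++-map : (f : A → B) (xs : Vector A m) (ys : Vector A n) →
         map f (xs ++ ys) ≗ map f xs ++ map f ys
++-map {m = m} f xs ys i with splitAt m i
... | inj₁ _ = refl
... | inj₂ _ = refl

-- Renaming of variables and its effect on satisfaction

module _ {L : Language o} where

  renameᵗ : (Fin m → Fin n) → Term L m → Term L n
  renameᵗ v (var i)    = var (v i)
  renameᵗ v (app f ts) = app f (λ j → renameᵗ v (ts j))

  renameᵃ : (Fin m → Fin n) → Atomic L m → Atomic L n
  renameᵃ v (t ≐′ u)   = renameᵗ v t ≐′ renameᵗ v u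
  renameᵃ v (rel R ts) = rel R (λ j → renameᵗ v (ts j))

  rename : (Fin m → Fin n) → Formula L m → Formula L n
  rename v (atom α) = atom (renameᵃ v α)
  rename v ⊤′       = ⊤′
  rename v ⊥′       = ⊥′
  rename v (¬′ φ)   = ¬′ rename v φ
  rename v (φ ∧′ ψ) = rename v φ ∧′ rename v ψ
  rename v (φ ∨′ ψ) = rename v φ ∨′ rename v ψ
  rename v (∃′ φ)   = ∃′ rename (lift 1 v) φ
  rename v (∀′ φ)   = ∀′ rename (lift 1 v) φ

module Satisfaction {L : Language o} (M : Structure L ℓ) where
  open Structure M hiding (Carrier)
  module ≈ = IsEquivalence ≈-equivalence

  infix 4 _≋_
  _≋_ : Rel (Tuple M n) ℓ
  a ≋ c = Pointwise _≈_ a c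

  head-∷-tail-++ : (c : Tuple M (suc m)) (a : Tuple M n) → c zero ∷ᵛ (c ∘ suc ++ a) ≋ c ++ a
  head-∷-tail-++         c a zero    = ≈.refl
  head-∷-tail-++ {m = m} c a (suc i) with splitAt m i
  ... | inj₁ _ = ≈.refl
  ... | inj₂ _ = ≈.refl

  eval-renameᵗ : (v : Fin m → Fin n) {ρ : Tuple M n} {a : Tuple M m} → ρ ∘ v ≋ a →
                 ∀ t → eval M ρ (renameᵗ v t) ≈ eval M a t
  eval-renameᵗ v p (var i)    = p i
  eval-renameᵗ v p (app f ts) = fun-cong f (λ j → eval-renameᵗ v p (ts j))

  ⊨ᵃ-rename : (v : Fin m → Fin n) {ρ : Tuple M n} {a : Tuple M m} → ρ ∘ v ≋ a →
              ∀ α → (M ⊨ᵃ renameᵃ v α [ ρ ]) ⇔ (M ⊨ᵃ α [ a ])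
  ⊨ᵃ-rename v p (t ≐′ u) = mk⇔
    (λ e → ≈.trans (≈.sym (eval-renameᵗ v p t)) (≈.trans e (eval-renameᵗ v p u)))
    (λ e → ≈.trans (eval-renameᵗ v p t) (≈.trans e (≈.sym (eval-renameᵗ v p u))))
  ⊨ᵃ-rename v p (rel R ts) = mk⇔
    (holds-resp R (λ j → eval-renameᵗ v p (ts j)))
    (holds-resp R (λ j → ≈.sym (eval-renameᵗ v p (ts j))))

  lift-≋ : (v : Fin m → Fin n) {ρ : Tuple M n} {a : Tuple M m} → ρ ∘ v ≋ a →
           ∀ x → (x ∷ᵛ ρ) ∘ lift 1 v ≋ x ∷ᵛ a
  lift-≋ v p x zero    = ≈.refl
  lift-≋ v p x (suc i) = p i

  -- Agreement of `ρ ∘ v` with `a` is asked only pointwise up to `_≈_`, because tuples are functions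
  -- and concatenations match only pointwise. The identity renaming then gives invariance of
  -- satisfaction under `≋`.
  ⊨-rename : (v : Fin m → Fin n) {ρ : Tuple M n} {a : Tuple M m} → ρ ∘ v ≋ a →
             ∀ φ → (M ⊨ rename v φ [ ρ ]) ⇔ (M ⊨ φ [ a ])
  ⊨-rename v p (atom α) = ⊨ᵃ-rename v p α
  ⊨-rename v p ⊤′       = ⇔-id _
  ⊨-rename v p ⊥′       = ⇔-id _
  ⊨-rename v p (¬′ φ)   = ¬-cong-⇔ (⊨-rename v p φ)
  ⊨-rename v p (φ ∧′ ψ) = ⊨-rename v p φ ×-⇔ ⊨-rename v p ψ
  ⊨-rename v p (φ ∨′ ψ) = ⊨-rename v p φ ⊎-⇔ ⊨-rename v p ψ
  ⊨-rename v p (∃′ φ)   = ∃-cong-⇔ λ x → ⊨-rename (lift 1 v) (lift-≋ v p x) φ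
  ⊨-rename v p (∀′ φ)   = Π-cong-⇔ λ x → ⊨-rename (lift 1 v) (lift-≋ v p x) φ

  ⊨-cong : {a c : Tuple M n} → a ≋ c → ∀ φ → (M ⊨ φ [ a ]) ⇔ (M ⊨ φ [ c ])
  ⊨-cong p φ = ⊨-rename (λ i → i) p φ ⇔-∘ ⇔-sym (⊨-rename (λ i → i) (λ i → ≈.refl) φ)

  ⊨-∃⋆ : ∀ m {a : Tuple M n} (φ : Formula L (m + n)) →
         (M ⊨ ∃⋆ m φ [ a ]) ⇔ (∃ λ (c : Tuple M m) → M ⊨ φ [ c ++ a ])
  ⊨-∃⋆ zero    φ = mk⇔ (λ h → []ᵛ , h) (λ (_ , h) → h)
  ⊨-∃⋆ (suc m) {a} φ = mk⇔
    (λ (c , x , h) → x ∷ᵛ c , to (⊨-cong (head-∷-tail-++ (x ∷ᵛ c) a) φ) h)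
    (λ (c , h) → c ∘ suc , c zero , from (⊨-cong (head-∷-tail-++ c a) φ) h)
    ⇔-∘ ⊨-∃⋆ m (∃′ φ)

  -- A formula is placed in a larger context along a map v listing a block of
  -- variables; ρ ∘ v ≋ a says that this block has the value a in ρ.
  ++-reads : (ρ : Tuple M n) (v : Fin m → Fin n) (w : Fin k → Fin n)
             {a : Tuple M m} {c : Tuple M k} →
             ρ ∘ v ≋ a → ρ ∘ w ≋ c → ρ ∘ (v ++ w) ≋ a ++ c
  ++-reads {m = m} ρ v w p q i with splitAt m i
  ... | inj₁ j = p j
  ... | inj₂ j = q j

  ↑ˡ-reads : (a : Tuple M m) (c : Tuple M n) → (a ++ c) ∘ (_↑ˡ n) ≋ a
  ↑ˡ-reads a c i = ≈.reflexive (lookup-++ˡ a c i)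

  ↑ʳ-reads : (a : Tuple M m) (c : Tuple M n) → (a ++ c) ∘ (m ↑ʳ_) ≋ c
  ↑ʳ-reads a c i = ≈.reflexive (lookup-++ʳ a c i)

  ↑ʳ∘-reads : ∀ {l} (c : Tuple M m) (ρ : Tuple M n) (v : Vector (Fin n) l) {a : Tuple M l} →
              ρ ∘ v ≋ a → (c ++ ρ) ∘ ((m ↑ʳ_) ∘ v) ≋ a
  ↑ʳ∘-reads c ρ v p i = ≈.trans (↑ʳ-reads c ρ (v i)) (p i)

-- Classical induction on formulae

module _ {L : Language o} {ℓ} (em : ExcludedMiddle ℓ) where

  ∨-deMorgan : (φ ψ : Formula L n) → LogicallyEquivalent ℓ (¬′ (¬′ φ ∧′ ¬′ ψ)) (φ ∨′ ψ)
  ∨-deMorgan φ ψ M ρ = mk⇔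
    (λ h → decidable-stable em λ g → h ((g ∘ inj₁) , (g ∘ inj₂)))
    (λ h (f , g) → [ f , g ] h)

  ∀-deMorgan : (φ : Formula L (suc n)) → LogicallyEquivalent ℓ (¬′ (∃′ ¬′ φ)) (∀′ φ)
  ∀-deMorgan φ M ρ = mk⇔
    (λ h x → decidable-stable em λ g → h (x , g))
    (λ h (x , g) → g (h x))

  -- Classically `⊥′`, `∨′` and `∀′` are definable from the other connectives, so a property
  -- invariant under logical equivalence need be checked only on those.
  classical-induction : (P : ∀ {n} → Formula L n → Set p) →
    (∀ {n} {φ ψ : Formula L n} → LogicallyEquivalent ℓ φ ψ → P φ → P ψ) →
    (∀ {n} (α : Atomic L n) → P (atom α)) →
    (∀ {n} → P {n} ⊤′) →
    (∀ {n} {φ : Formula L n} → P φ → P (¬′ φ)) →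
    (∀ {n} {φ ψ : Formula L n} → P φ → P ψ → P (φ ∧′ ψ)) →
    (∀ {n} {φ : Formula L (suc n)} → P φ → P (∃′ φ)) →
    ∀ {n} (φ : Formula L n) → P φ
  classical-induction P resp at top neg and ex = go
    where
    go : ∀ {n} (φ : Formula L n) → P φ
    go (atom α) = at α
    go ⊤′       = top
    go ⊥′       = resp (λ M ρ → mk⇔ (λ h → contradiction _ h) ⊥-elim) (neg top)
    go (¬′ φ)   = neg (go φ)
    go (φ ∧′ ψ) = and (go φ) (go ψ)
    go (φ ∨′ ψ) = resp (∨-deMorgan φ ψ) (neg (and (neg (go φ)) (neg (go ψ))))
    go (∃′ φ)   = ex (go φ)
    go (∀′ φ)   = resp (∀-deMorgan φ) (neg (ex (neg (go φ))))

-- Translation of Boolean formulae through an interpretation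

module Translation {L : Language o} {k} {Θ : InterpretingFormulae L k}
                   {B : Structure LBool b} {M : Structure L ℓ} (I : Interpretation Θ B M) where
  open Interpretation I
  open InterpretingFormulae Θ
  open Satisfaction M
  open Structure B using (fun; fun-cong) renaming (_≈_ to _≈ᴮ_; ≈-equivalence to ≈ᴮ-equivalence)
  private
    module ≈ᴮ = IsEquivalence ≈ᴮ-equivalence
    module 𝔹 = Satisfaction B

  -- Relative to a single tuple a: in translatable-∃, part of a is a bound block,
  -- about which something is known only when it lies in Dom.
  Represents : Formula L (n + k) → Tuple M n → Carrier B → Set (b ⊔ ℓ)
  Represents Υ a X = ∀ (d : Dom) → (M ⊨ Υ [ a ++ proj₁ d ]) ⇔ (F d ≈ᴮ X)

  -- Relativised quantifier over the codes of elements of `B`. As `F` is surjective, it amounts to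
  -- quantification over `B`.
  ∃ᴰ : Formula L (k + n) → Formula L n
  ∃ᴰ {n} ψ = ∃⋆ k (rename (_↑ˡ n) Θ𝓑 ∧′ ψ)

  ⊨-∃ᴰ : (ψ : Formula L (k + n)) {a : Tuple M n} →
         (M ⊨ ∃ᴰ ψ [ a ]) ⇔ (∃ λ (d : Dom) → M ⊨ ψ [ proj₁ d ++ a ])
  ⊨-∃ᴰ ψ {a} = mk⇔
    (λ (c , t , h) → (c , to (⊨-rename (_↑ˡ _) (↑ˡ-reads c a) Θ𝓑) t) , h)
    (λ ((c , t) , h) → c , from (⊨-rename (_↑ˡ _) (↑ˡ-reads c a) Θ𝓑) t , h)
    ⇔-∘ ⊨-∃⋆ k (rename (_↑ˡ _) Θ𝓑 ∧′ ψ)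

  represents-constant : (s : BoolSym 0) (Θ₀ : Formula L k) →
    (∀ d → (F d ≈ᴮ fun s []ᵛ) ⇔ (M ⊨ Θ₀ [ proj₁ d ])) →
    ∀ {a : Tuple M n} {X} → Represents (rename (n ↑ʳ_) Θ₀) a (fun s X)
  represents-constant {n} s Θ₀ iff {a} d =
    -- `X` is an empty tuple but not `[]ᵛ` by definition, hence the congruence over no arguments.
    mk⇔ (λ e → ≈ᴮ.trans e (fun-cong s λ ())) (λ e → ≈ᴮ.trans e (fun-cong s λ ()))
    ⇔-∘ (⇔-sym (iff d) ⇔-∘ ⊨-rename (n ↑ʳ_) (↑ʳ-reads a (proj₁ d)) Θ₀)

  -- The application is unnested: a code `c` of the argument is guessed, and `Θ₁` relates it to the
  -- code `d` of the value. Surjectivity of `F` supplies the guess.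
  represents-unary : (s : BoolSym 1) (Θ₁ : Formula L (k + k)) →
    (∀ x y → (fun s (F x ∷ᵛ []ᵛ) ≈ᴮ F y) ⇔ (M ⊨ Θ₁ [ proj₁ x ++ proj₁ y ])) →
    (Υ : Vector (Formula L (n + k)) 1) →
    ∃ λ Ψ → ∀ {a : Tuple M n} {X} → (∀ i → Represents (Υ i) a (X i)) → Represents Ψ a (fun s X)
  represents-unary {n} s Θ₁ iff Υ = ∃ᴰ ψ , correct
    where
    -- Positions of the blocks in the context `c ++ (a ++ d)`, where `c` is the bound block.
    va : Vector (Fin (k + (n + k))) n
    va i = k ↑ʳ (i ↑ˡ k)
    vc vd : Vector (Fin (k + (n + k))) k
    vc i = i ↑ˡ (n + k)
    vd i = k ↑ʳ (n ↑ʳ i)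
    ψ = rename (va ++ vc) (Υ zero) ∧′ rename (vc ++ vd) Θ₁

    correct : ∀ {a X} → (∀ i → Represents (Υ i) a (X i)) → Represents (∃ᴰ ψ) a (fun s X)
    correct {a} {X} rep d = mk⇔
      (λ (c , h) → let (u , t) = to (at c) h in
        ≈ᴮ.trans (≈ᴮ.sym (from (iff c d) t)) (fun-cong s λ { zero → to (rep zero c) u }))
      (λ h → let (c , Fc) = F-surjective (X zero) in
        c , from (at c) (from (rep zero c) Fc , to (iff c d)
          (≈ᴮ.trans (fun-cong s λ { zero → Fc }) (≈ᴮ.sym h))))
      ⇔-∘ ⊨-∃ᴰ ψ
      where
      at : ∀ c → (M ⊨ ψ [ proj₁ c ++ (a ++ proj₁ d) ]) ⇔
           ((M ⊨ Υ zero [ a ++ proj₁ c ]) × (M ⊨ Θ₁ [ proj₁ c ++ proj₁ d ]))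
      at (c , _) =
        ⊨-rename (va ++ vc) (++-reads ρ va vc ra rc) (Υ zero)
        ×-⇔ ⊨-rename (vc ++ vd) (++-reads ρ vc vd rc rd) Θ₁
        where
        σ = a ++ proj₁ d
        ρ = c ++ σ
        ra : ρ ∘ va ≋ a
        ra = ↑ʳ∘-reads c σ (_↑ˡ k) (↑ˡ-reads a (proj₁ d))
        rc : ρ ∘ vc ≋ c
        rc = ↑ˡ-reads c σ
        rd : ρ ∘ vd ≋ proj₁ d
        rd = ↑ʳ∘-reads c σ (n ↑ʳ_) (↑ʳ-reads a (proj₁ d))

  represents-binary : (s : BoolSym 2) (Θ₂ : Formula L (k + (k + k))) →
    (∀ x y z → (fun s (F x ∷ᵛ F y ∷ᵛ []ᵛ) ≈ᴮ F z)
               ⇔ (M ⊨ Θ₂ [ proj₁ x ++ (proj₁ y ++ proj₁ z) ])) →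
    (Υ : Vector (Formula L (n + k)) 2) →
    ∃ λ Ψ → ∀ {a : Tuple M n} {X} → (∀ i → Represents (Υ i) a (X i)) → Represents Ψ a (fun s X)
  represents-binary {n} s Θ₂ iff Υ = ∃ᴰ (∃ᴰ ψ) , correct
    where
    -- The inner `∃ᴰ` puts its block in front, so the context is `e ++ (c ++ (a ++ d))`.
    va : Vector (Fin (k + (k + (n + k)))) n
    va i = k ↑ʳ (k ↑ʳ (i ↑ˡ k))
    vd vc ve : Vector (Fin (k + (k + (n + k)))) k
    vd i = k ↑ʳ (k ↑ʳ (n ↑ʳ i))
    vc i = k ↑ʳ (i ↑ˡ (n + k))
    ve i = i ↑ˡ (k + (n + k))
    ψ = rename (va ++ vc) (Υ zero) ∧′ rename (va ++ ve) (Υ (suc zero))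
        ∧′ rename (vc ++ (ve ++ vd)) Θ₂

    correct : ∀ {a X} → (∀ i → Represents (Υ i) a (X i)) → Represents (∃ᴰ (∃ᴰ ψ)) a (fun s X)
    correct {a} {X} rep d = mk⇔
      (λ (c , e , h) → let (u , u′ , t) = to (at c e) h in ≈ᴮ.trans
        (≈ᴮ.sym (from (iff c e d) t))
        (fun-cong s λ { zero → to (rep zero c) u ; (suc zero) → to (rep (suc zero) e) u′ }))
      (λ h → let (c , Fc) = F-surjective (X zero)
                 (e , Fe) = F-surjective (X (suc zero)) in
        c , e , from (at c e)
          (from (rep zero c) Fc , from (rep (suc zero) e) Fe , to (iff c e d)
            (≈ᴮ.trans (fun-cong s λ { zero → Fc ; (suc zero) → Fe }) (≈ᴮ.sym h))))
      ⇔-∘ (∃-cong-⇔ (λ c → ⊨-∃ᴰ ψ) ⇔-∘ ⊨-∃ᴰ (∃ᴰ ψ))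
      where
      at : ∀ c e → (M ⊨ ψ [ proj₁ e ++ (proj₁ c ++ (a ++ proj₁ d)) ]) ⇔
           ((M ⊨ Υ zero [ a ++ proj₁ c ]) × (M ⊨ Υ (suc zero) [ a ++ proj₁ e ])
             × (M ⊨ Θ₂ [ proj₁ c ++ (proj₁ e ++ proj₁ d) ]))
      at (c , _) (e , _) =
        ⊨-rename (va ++ vc) (++-reads ρ va vc ra rc) (Υ zero)
        ×-⇔ ⊨-rename (va ++ ve) (++-reads ρ va ve ra re) (Υ (suc zero))
        ×-⇔ ⊨-rename (vc ++ (ve ++ vd)) (++-reads ρ vc (ve ++ vd) rc (++-reads ρ ve vd re rd)) Θ₂
        where
        τ = a ++ proj₁ d
        σ = c ++ τ
        ρ = e ++ σ
        ra : ρ ∘ va ≋ a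
        ra = ↑ʳ∘-reads e σ _ (↑ʳ∘-reads c τ (_↑ˡ k) (↑ˡ-reads a (proj₁ d)))
        rc : ρ ∘ vc ≋ c
        rc = ↑ʳ∘-reads e σ (_↑ˡ (n + k)) (↑ˡ-reads c τ)
        re : ρ ∘ ve ≋ e
        re = ↑ˡ-reads e σ
        rd : ρ ∘ vd ≋ proj₁ d
        rd = ↑ʳ∘-reads e σ _ (↑ʳ∘-reads c τ (n ↑ʳ_) (↑ʳ-reads a (proj₁ d)))

  represents-fun : ∀ {r} (s : BoolSym r) (Υ : Vector (Formula L (n + k)) r) →
    ∃ λ Ψ → ∀ {a : Tuple M n} {X} → (∀ i → Represents (Υ i) a (X i)) → Represents Ψ a (fun s X)
  represents-fun {n} 0ˢ Υ = rename (n ↑ʳ_) Θ0 , λ _ → represents-constant 0ˢ Θ0 0-iff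
  represents-fun {n} 1ˢ Υ = rename (n ↑ʳ_) Θ1 , λ _ → represents-constant 1ˢ Θ1 1-iff
  represents-fun ▽ˢ Υ = represents-binary ▽ˢ Θ▽ ▽-iff Υ
  represents-fun △ˢ Υ = represents-binary △ˢ Θ△ △-iff Υ
  represents-fun Cˢ Υ = represents-unary Cˢ ΘC C-iff Υ

  represents-term : (t : Term LBool m) (Υ : Vector (Formula L (n + k)) m) →
    ∃ λ Ψ → ∀ {a : Tuple M n} {X} → (∀ i → Represents (Υ i) a (X i)) → Represents Ψ a (eval B X t)
  represents-term (var i)    Υ = Υ i , λ rep → rep i
  represents-term (app s ts) Υ =
    let (Ψ , correct) = represents-fun s λ j → proj₁ (represents-term (ts j) Υ) in
    Ψ , λ rep → correct λ j → proj₂ (represents-term (ts j) Υ) rep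

  -- `n` and `Υ` are universally quantified because a bound Boolean variable lengthens the tuple `a`
  -- by a block of length `k` and adds a formula to `Υ`. As `ψ` is chosen before `a` and `X`, the
  -- translation is uniform in them.
  Translatable : Formula LBool m → Set (o ⊔ ℓ ⊔ b)
  Translatable {m} Φ = ∀ n (Υ : Vector (Formula L (n + k)) m) →
    ∃ λ (ψ : Formula L n) → ∀ {a X} → (∀ i → Represents (Υ i) a (X i)) →
      (M ⊨ ψ [ a ]) ⇔ (B ⊨ Φ [ X ])

  -- Two elements of `B` are equal iff a single `d` codes both; surjectivity of `F` provides a code
  -- for the value of `t`.
  translatable-atom : (α : Atomic LBool m) → Translatable (atom α)
  translatable-atom (rel () _)
  translatable-atom (t ≐′ u) n Υ = ∃ᴰ ψ , correct
    where
    v : Fin (n + k) → Fin (k + n)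
    v = (k ↑ʳ_) ++ (_↑ˡ n)
    graph : Term LBool _ → Formula L (n + k)
    graph t = proj₁ (represents-term t Υ)
    ψ = rename v (graph t) ∧′ rename v (graph u)

    correct : ∀ {a X} → (∀ i → Represents (Υ i) a (X i)) →
              (M ⊨ ∃ᴰ ψ [ a ]) ⇔ (eval B X t ≈ᴮ eval B X u)
    correct {a} {X} rep = mk⇔
      (λ (d , h , h′) → ≈ᴮ.trans (≈ᴮ.sym (to (at d t) h)) (to (at d u) h′))
      (λ e → let (d , Fd) = F-surjective (eval B X t) in
        d , from (at d t) Fd , from (at d u) (≈ᴮ.trans Fd e))
      ⇔-∘ ⊨-∃ᴰ ψ
      where
      at : ∀ d t → (M ⊨ rename v (graph t) [ proj₁ d ++ a ]) ⇔ (F d ≈ᴮ eval B X t)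
      at d@(c , _) t = proj₂ (represents-term t Υ) rep d ⇔-∘
        ⊨-rename v (++-reads (c ++ a) (k ↑ʳ_) (_↑ˡ n) (↑ʳ-reads c a) (↑ˡ-reads c a)) (graph t)

  -- The bound element of `B` is replaced by a code `d`, which joins the free variables. The new
  -- value `F d` is represented by `Θ=` with `d` as its first block.
  translatable-∃ : {Φ : Formula LBool (suc m)} → Translatable Φ → Translatable (∃′ Φ)
  translatable-∃ {m} {Φ} tr n Υ = ∃ᴰ ψ , λ {a} {X} rep → mk⇔
      (λ (d , h) → F d , to (correct (rep′ rep d)) h)
      (λ (Y , h) → let (d , Fd) = F-surjective Y in
        d , from (correct (rep′ rep d))
              (from (𝔹.⊨-cong (λ { zero → Fd ; (suc i) → ≈ᴮ.refl }) Φ) h))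
      ⇔-∘ ⊨-∃ᴰ ψ
    where
    vc ve : Vector (Fin ((k + n) + k)) k
    vc i = (i ↑ˡ n) ↑ˡ k
    ve = (k + n) ↑ʳ_
    va : Vector (Fin ((k + n) + k)) n
    va i = (k ↑ʳ i) ↑ˡ k
    Υ′ : Vector (Formula L ((k + n) + k)) (suc m)
    Υ′ = rename (vc ++ ve) Θ= ∷ᵛ λ i → rename (va ++ ve) (Υ i)

    ψ = proj₁ (tr (k + n) Υ′)
    correct = λ {a} {X} → proj₂ (tr (k + n) Υ′) {a} {X}

    module _ (c : Tuple M k) (a : Tuple M n) (e : Tuple M k) where
      ρ = (c ++ a) ++ e
      rc : ρ ∘ vc ≋ c
      rc i = ≈.trans (↑ˡ-reads (c ++ a) e (i ↑ˡ n)) (↑ˡ-reads c a i)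
      ra : ρ ∘ va ≋ a
      ra i = ≈.trans (↑ˡ-reads (c ++ a) e (k ↑ʳ i)) (↑ʳ-reads c a i)
      re : ρ ∘ ve ≋ e
      re = ↑ʳ-reads (c ++ a) e
      rce : ρ ∘ (vc ++ ve) ≋ c ++ e
      rce = ++-reads ρ vc ve rc re
      rae : ρ ∘ (va ++ ve) ≋ a ++ e
      rae = ++-reads ρ va ve ra re

    rep′ : ∀ {a X} → (∀ i → Represents (Υ i) a (X i)) →
           ∀ d i → Represents (Υ′ i) (proj₁ d ++ a) ((F d ∷ᵛ X) i)
    rep′ {a} rep d@(c , _) zero e@(c′ , _) =
      mk⇔ ≈ᴮ.sym ≈ᴮ.sym ⇔-∘ (⇔-sym (=-iff d e) ⇔-∘ ⊨-rename (vc ++ ve) (rce c a c′) Θ=)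
    rep′ {a} rep d@(c , _) (suc j) e@(c′ , _) =
      rep j e ⇔-∘ ⊨-rename (va ++ ve) (rae c a c′) (Υ j)

  translatable : ExcludedMiddle b → (Φ : Formula LBool m) → Translatable Φ
  translatable em = classical-induction em Translatable
    (λ e tr n Υ → let (ψ , c) = tr n Υ in ψ , λ {_} {X} rep → e B X ⇔-∘ c rep)
    translatable-atom
    (λ n Υ → ⊤′ , λ _ → mk⇔ _ _)
    (λ tr n Υ → let (ψ , c) = tr n Υ in ¬′ ψ , λ rep → ¬-cong-⇔ (c rep))
    (λ tr tr′ n Υ → let (ψ , c) = tr n Υ ; (ψ′ , c′) = tr′ n Υ in
      ψ ∧′ ψ′ , λ rep → c rep ×-⇔ c′ rep)
    (λ {_} {Φ} → translatable-∃ {Φ = Φ})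

-- Definability of the greatest set coded by the solutions of a formula

module _ {L : Language o} {Λ : Set ℓ} {k} {Θ : InterpretingFormulae L k} {M : Structure L ℓ}
         (em : ExcludedMiddle ℓ) (I : Interpretation Θ (𝒫 Λ) M) where
  open Interpretation I
  open InterpretingFormulae Θ
  open Satisfaction M
  open Translation I
  open Structure (𝒫 Λ) using () renaming (_≈_ to _≈ᴮ_)

  -- By the two hypotheses, `X` contains every set coded by a solution of `ψ` and is itself such a
  -- set. Its codes are therefore the solutions of `ψ` whose set is maximal.
  represents-greatest : (ψ : Formula L (n + k)) → ∃ λ Υ → ∀ {a : Tuple M n} {X : Pred Λ ℓ} →
    (∀ d → M ⊨ ψ [ a ++ proj₁ d ] → F d ⊆ X) →
    (∀ d → F d ≈ᴮ X → M ⊨ ψ [ a ++ proj₁ d ]) →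
    Represents Υ a X
  represents-greatest {n} ψ = (ψ ∧′ ¬′ ∃ᴰ χ) , correct
    where
    va : Vector (Fin (k + (n + k))) n
    va i = k ↑ʳ (i ↑ˡ k)
    vc vd : Vector (Fin (k + (n + k))) k
    vc i = i ↑ˡ (n + k)
    vd i = k ↑ʳ (n ↑ʳ i)
    -- `χ` describes a counterexample to maximality of `d`: a solution `c` of `ψ` with `F c` not
    -- below `F d`, the order being read off from `F c △ F d = F c`.
    χ = rename (va ++ vc) ψ ∧′ ¬′ rename (vc ++ (vd ++ vc)) Θ△

    correct : ∀ {a X} → (∀ d → M ⊨ ψ [ a ++ proj₁ d ] → F d ⊆ X) →
              (∀ d → F d ≈ᴮ X → M ⊨ ψ [ a ++ proj₁ d ]) → Represents (ψ ∧′ ¬′ ∃ᴰ χ) a X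
    correct {a} {X} sound complete d = mk⇔ to′ from′
      where
      at : ∀ c → (M ⊨ χ [ proj₁ c ++ (a ++ proj₁ d) ]) ⇔
           ((M ⊨ ψ [ a ++ proj₁ c ]) × ¬ ((F c ∩ F d) ≈ᴮ F c))
      at c′@(c , _) =
        ⊨-rename (va ++ vc) (++-reads ρ va vc ra rc) ψ
        ×-⇔ ¬-cong-⇔ (⇔-sym (△-iff c′ d c′) ⇔-∘
              ⊨-rename (vc ++ (vd ++ vc))
                (++-reads ρ vc (vd ++ vc) rc (++-reads ρ vd vc rd rc)) Θ△)
        where
        σ = a ++ proj₁ d
        ρ = c ++ σ
        ra : ρ ∘ va ≋ a
        ra = ↑ʳ∘-reads c σ (_↑ˡ k) (↑ˡ-reads a (proj₁ d))
        rc : ρ ∘ vc ≋ c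
        rc = ↑ˡ-reads c σ
        rd : ρ ∘ vd ≋ proj₁ d
        rd = ↑ʳ∘-reads c σ (n ↑ʳ_) (↑ʳ-reads a (proj₁ d))

      to′ : M ⊨ ψ ∧′ ¬′ ∃ᴰ χ [ a ++ proj₁ d ] → F d ≈ᴮ X
      -- A point of `X` outside `F d` would turn any code `c` of `X` into a counterexample to
      -- maximality.
      to′ (h , max) = llift (sound d h , λ x∈X → decidable-stable em λ x∉Fd →
        let (c , Fc≈X) = F-surjective X in
        max (from (⊨-∃ᴰ χ) (c , from (at c) (complete c Fc≈X , λ (llift (_ , Fc⊆)) →
          x∉Fd (proj₂ (Fc⊆ (proj₂ (lower Fc≈X) x∈X)))))))

      from′ : F d ≈ᴮ X → M ⊨ ψ ∧′ ¬′ ∃ᴰ χ [ a ++ proj₁ d ]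
      from′ e = complete d e , λ h →
        let (c , g) = to (⊨-∃ᴰ χ) h
            (hc , ¬e) = to (at c) g in
        ¬e (llift (proj₁ , λ x∈Fc → x∈Fc , proj₂ (lower e) (sound c hc x∈Fc)))

-- Positive primitive formulae in direct products

module _ {L : Language o} {Λ : Set ℓ} (𝒜 : Λ → Structure L ℓ) where

  coord-++ : (a : Tuple (∏ 𝒜) m) (c : Tuple (∏ 𝒜) n) (i : Λ) →
             Pointwise (Structure._≈_ (𝒜 i)) (coord 𝒜 (a ++ c) i) (coord 𝒜 a i ++ coord 𝒜 c i)
  coord-++ a c i j = Satisfaction.≈.reflexive (𝒜 i) (++-map (λ x → x i) a c j)

  coord-∷ : (x : Carrier (∏ 𝒜)) (a : Tuple (∏ 𝒜) n) (i : Λ) →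
            Pointwise (Structure._≈_ (𝒜 i)) (coord 𝒜 (x ∷ᵛ a) i) (x i ∷ᵛ coord 𝒜 a i)
  coord-∷ x a i zero    = Satisfaction.≈.refl (𝒜 i)
  coord-∷ x a i (suc j) = Satisfaction.≈.refl (𝒜 i)

  eval-coord : (a : Tuple (∏ 𝒜) n) (i : Λ) (t : Term L n) →
               Structure._≈_ (𝒜 i) (eval (∏ 𝒜) a t i) (eval (𝒜 i) (coord 𝒜 a i) t)
  eval-coord a i (var j)    = Satisfaction.≈.refl (𝒜 i)
  eval-coord a i (app f ts) = Structure.fun-cong (𝒜 i) f λ j → eval-coord a i (ts j)

  ⊨-∏-atom : (α : Atomic L n) {a : Tuple (∏ 𝒜) n} →
             (∏ 𝒜 ⊨ atom α [ a ]) ⇔ (∀ i → i ∈ K 𝒜 (atom α) a)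
  ⊨-∏-atom (t ≐′ u) {a} = Π-cong-⇔ λ i → let open Satisfaction (𝒜 i) in mk⇔
    (λ e → ≈.trans (≈.sym (eval-coord a i t)) (≈.trans e (eval-coord a i u)))
    (λ e → ≈.trans (eval-coord a i t) (≈.trans e (≈.sym (eval-coord a i u))))
  ⊨-∏-atom (rel R ts) {a} = Π-cong-⇔ λ i → let open Satisfaction (𝒜 i) in mk⇔
    (Structure.holds-resp (𝒜 i) R (λ j → eval-coord a i (ts j)))
    (Structure.holds-resp (𝒜 i) R (λ j → ≈.sym (eval-coord a i (ts j))))

  ⊨-∏-⋀ : (Φ : List (Atomic L n)) {a : Tuple (∏ 𝒜) n} →
          (∏ 𝒜 ⊨ ⋀ Φ [ a ]) ⇔ (∀ i → i ∈ K 𝒜 (⋀ Φ) a)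
  ⊨-∏-⋀ []      = mk⇔ _ _
  ⊨-∏-⋀ (α ∷ Φ) = mk⇔
    (λ (h , t) i → to (⊨-∏-atom α) h i , to (⊨-∏-⋀ Φ) t i)
    (λ h → from (⊨-∏-atom α) (proj₁ ∘ h) , from (⊨-∏-⋀ Φ) (proj₂ ∘ h))

  -- Conjunctions of atoms hold coordinatewise, and witnesses found separately in each coordinate
  -- assemble into one tuple of the product. The given equivalence is applied both in `∏ 𝒜` and in
  -- every `𝒜 i`.
  ⊨-∏-pp : (φ : Formula L n) → PositivePrimitive ℓ φ → {a : Tuple (∏ 𝒜) n} →
           (∏ 𝒜 ⊨ φ [ a ]) ⇔ (∀ i → i ∈ K 𝒜 φ a)
  ⊨-∏-pp φ (m , Φ , e) {a} =
    Π-cong-⇔ (λ i → ⇔-sym (e (𝒜 i) (coord 𝒜 a i))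
                    ⇔-∘ ⇔-sym (Satisfaction.⊨-∃⋆ (𝒜 i) m (⋀ Φ)))
    ⇔-∘ (choice
    ⇔-∘ (∃-cong-⇔ (λ c → Π-cong-⇔ (λ i → Satisfaction.⊨-cong (𝒜 i) (coord-++ c a i) (⋀ Φ))
                      ⇔-∘ ⊨-∏-⋀ Φ)
    ⇔-∘ (Satisfaction.⊨-∃⋆ (∏ 𝒜) m (⋀ Φ)
    ⇔-∘ e (∏ 𝒜) a)))
    where
    choice : (∃ λ (c : Tuple (∏ 𝒜) m) → ∀ i → 𝒜 i ⊨ ⋀ Φ [ coord 𝒜 c i ++ coord 𝒜 a i ]) ⇔
             (∀ i → ∃ λ c → 𝒜 i ⊨ ⋀ Φ [ c ++ coord 𝒜 a i ])
    choice = mk⇔ (λ (c , h) i → coord 𝒜 c i , h i)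
                 (λ h → (λ j i → proj₁ (h i) j) , λ i → proj₂ (h i))

-- From (A) to (B): gluing two-element algebras into a power set

module _ {Λ : Set ℓ} where
  open Structure (𝒫 Λ) using (_≈_)

  ⟪_⟫ : (Λ → Bool) → Pred Λ ℓ
  ⟪ f ⟫ i = Lift ℓ (T (f i))

  ∈-⟪⟫ : (f : Λ → Bool) → ∀ i → i ∈ ⟪ f ⟫ ⇔ T (f i)
  ∈-⟪⟫ f i = mk⇔ lower llift

  -- Turns a set equation into equations of bits, to which the interpretations of `𝟚` apply. `X`
  -- stays general because a Boolean combination of sets `⟪ f ⟫` is not literally of that form.
  ≈-⟪⟫ : {f : Λ → Bool} {X : Pred Λ ℓ} {g : Λ → Bool} →
         (∀ i → i ∈ X ⇔ T (f i)) → (X ≈ ⟪ g ⟫) ⇔ (∀ i → f i ≡ g i)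
  ≈-⟪⟫ {f} {X} {g} X≈f = mk⇔
    (λ (llift (X⊆ , ⊆X)) i → ⇔→≡ (T-≡ ⇔-∘ (
      mk⇔ (λ h → lower (X⊆ (from (X≈f i) h))) (λ h → to (X≈f i) (⊆X (llift h))) ⇔-∘ ⇔-sym T-≡)))
    (λ e → llift ((λ {i} h → llift (subst T (e i) (to (X≈f i) h)))
                 , λ {i} (llift h) → from (X≈f i) (subst T (sym (e i)) h)))

-- `Θ=` sees only the tuple, so its truth for `(x , h)` against itself also compares `h` with `h′`.
F-irrelevant : {L : Language o} {Θ : InterpretingFormulae L k}
               {B : Structure LBool b} {M : Structure L ℓ}
               (I : Interpretation Θ B M) → let open Interpretation I in
               ∀ {x} h h′ → Structure._≈_ B (F (x , h)) (F (x , h′))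
F-irrelevant {B = B} I {x} h h′ =
  from (=-iff (x , h) (x , h′)) (to (=-iff (x , h) (x , h)) (Satisfaction.≈.refl B))
  where open Interpretation I

module _ {L : Language o} {Λ : Set ℓ} (𝒜 : Λ → Structure L ℓ)
         {k} {Θ : InterpretingFormulae L k} (em : ExcludedMiddle ℓ)
         (Θ-pp : AllPositivePrimitive ℓ Θ) (I : ∀ i → Interpretation Θ 𝟚 (𝒜 i)) where
  open InterpretingFormulae Θ
  open AllPositivePrimitive Θ-pp
  private
    module I i = Interpretation (I i)

    Domain : Set ℓ
    Domain = ∃ λ (x : Tuple (∏ 𝒜) k) → ∏ 𝒜 ⊨ Θ𝓑 [ x ]

    dom : Domain → ∀ i → I.Dom i
    dom (x , h) i = coord 𝒜 x i , to (⊨-∏-pp 𝒜 Θ𝓑 Θ𝓑-pp) h i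

    bit : Domain → Λ → Bool
    bit x i = I.F i (dom x i)

    -- Common pattern of the clauses of `power-interpretation`: a set equation is a family of bit
    -- equations, `φ` expresses each of them in its coordinate, and being positive primitive it
    -- passes to the product.
    bits-iff : ∀ (φ : Formula L n) → PositivePrimitive ℓ φ → {a : Tuple (∏ 𝒜) n}
               {X : Pred Λ ℓ} {f g : Λ → Bool} → (∀ i → i ∈ X ⇔ T (f i)) →
               (∀ i → (f i ≡ g i) ⇔ (i ∈ K 𝒜 φ a)) →
               Structure._≈_ (𝒫 Λ) X ⟪ g ⟫ ⇔ (∏ 𝒜 ⊨ φ [ a ])
    bits-iff φ φ-pp X≈f h = ⇔-sym (⊨-∏-pp 𝒜 φ φ-pp) ⇔-∘ (Π-cong-⇔ h ⇔-∘ ≈-⟪⟫ X≈f)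

    coord-++₂ : ∀ (φ : Formula L (k + k)) (x y : Tuple (∏ 𝒜) k) i →
                (𝒜 i ⊨ φ [ coord 𝒜 x i ++ coord 𝒜 y i ]) ⇔ (i ∈ K 𝒜 φ (x ++ y))
    coord-++₂ φ x y i = ⇔-sym (Satisfaction.⊨-cong (𝒜 i) (coord-++ 𝒜 x y i) φ)

    coord-++₃ : ∀ (φ : Formula L (k + (k + k))) (x y z : Tuple (∏ 𝒜) k) i →
                (𝒜 i ⊨ φ [ coord 𝒜 x i ++ (coord 𝒜 y i ++ coord 𝒜 z i) ])
                ⇔ (i ∈ K 𝒜 φ (x ++ (y ++ z)))
    coord-++₃ φ x y z i = ⇔-sym (Satisfaction.⊨-cong (𝒜 i) (λ j →
      ≈.trans (coord-++ 𝒜 x (y ++ z) i j)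
              (++⁺ (Structure._≈_ (𝒜 i)) {xs = coord 𝒜 x i} (λ _ → ≈.refl)
                (coord-++ 𝒜 y z i) j)) φ)
      where open Satisfaction (𝒜 i)

  power-interpretation : Interpretation Θ (𝒫 Λ) (∏ 𝒜)
  power-interpretation = record
    { F = λ x → ⟪ bit x ⟫
    ; F-surjective = surjective
    ; =-iff = λ x y → bits-iff Θ= Θ=-pp (∈-⟪⟫ (bit x)) λ i →
        coord-++₂ Θ= (proj₁ x) (proj₁ y) i ⇔-∘ I.=-iff i (dom x i) (dom y i)
    -- `bits-iff` wants the set `⟪ bit x ⟫` on the right, so for the two constants the equation is
    -- turned round.
    ; 0-iff = λ x → bits-iff Θ0 Θ0-pp {f = λ _ → false} (λ i → mk⇔ (λ ()) (λ ()))
        (λ i → I.0-iff i (dom x i) ⇔-∘ mk⇔ sym sym) ⇔-∘ ≈-sym-⇔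
    ; 1-iff = λ x → bits-iff Θ1 Θ1-pp {f = λ _ → true} (λ i → mk⇔ _ _)
        (λ i → I.1-iff i (dom x i) ⇔-∘ mk⇔ sym sym) ⇔-∘ ≈-sym-⇔
    ; △-iff = λ x y z → bits-iff Θ△ Θ△-pp
        (λ i → ⇔-sym (T-∧ {bit x i} {bit y i}) ⇔-∘ (∈-⟪⟫ (bit x) i ×-⇔ ∈-⟪⟫ (bit y) i)) λ i →
        coord-++₃ Θ△ (proj₁ x) (proj₁ y) (proj₁ z) i ⇔-∘ I.△-iff i (dom x i) (dom y i) (dom z i)
    ; ▽-iff = λ x y z → bits-iff Θ▽ Θ▽-pp
        (λ i → ⇔-sym (T-∨ {bit x i} {bit y i}) ⇔-∘ (∈-⟪⟫ (bit x) i ⊎-⇔ ∈-⟪⟫ (bit y) i)) λ i →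
        coord-++₃ Θ▽ (proj₁ x) (proj₁ y) (proj₁ z) i ⇔-∘ I.▽-iff i (dom x i) (dom y i) (dom z i)
    ; C-iff = λ x y → bits-iff ΘC ΘC-pp
        (λ i → T-not ⇔-∘ ¬-cong-⇔ (∈-⟪⟫ (bit x) i)) λ i →
        coord-++₂ ΘC (proj₁ x) (proj₁ y) i ⇔-∘ I.C-iff i (dom x i) (dom y i)
    }
    where
    T-not : ∀ {x} → (¬ T x) ⇔ T (not x)
    T-not {true}  = mk⇔ (λ h → h _) (λ ())
    T-not {false} = mk⇔ _ (λ _ ())

    ≈-sym-⇔ : ∀ {X Y : Pred Λ ℓ} → (Structure._≈_ (𝒫 Λ) X Y) ⇔ (Structure._≈_ (𝒫 Λ) Y X)
    ≈-sym-⇔ = mk⇔ (λ (llift (p , q)) → llift (q , p)) (λ (llift (p , q)) → llift (q , p))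

    surjective : ∀ X → ∃ λ x → Structure._≈_ (𝒫 Λ) ⟪ bit x ⟫ X
    surjective X = x , to ≈-sym-⇔ (from (≈-⟪⟫ λ i → mk⇔ fromWitness (toWitness {a? = em})) λ i →
        -- The proof of `Θ𝓑` inside `dom x i` has passed through the product and need not be the one
        -- that came with the preimage.
        sym (trans (F-irrelevant (I i) _ _) (proj₂ (preimage i))))
      where
      -- Excluded middle turns `X` into a family of bits, each of which has a code in its own
      -- coordinate.
      preimage : ∀ i → ∃ λ y → I.F i y ≡ ⌊ em {P = X i} ⌋
      preimage i = I.F-surjective i _
      x : Domain
      x = (λ j i → proj₁ (proj₁ (preimage i)) j) ,
          from (⊨-∏-pp 𝒜 Θ𝓑 Θ𝓑-pp) λ i → proj₂ (proj₁ (preimage i))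

  -- `Θ0` holds at `i` exactly when the bit of `d` is false there, so `Θ0 ∨ φ` is the implication
  -- from membership of `i` to `φ`. Being positive primitive, `φ₀` asserts it in the product for all
  -- `i` at once.
  ⊆K-represented : (φ : Atomic L n) (φ₀ : Formula L (n + k)) → PositivePrimitive ℓ φ₀ →
    (∀ i x y → (𝒜 i ⊨ Θ0 [ y ] ⊎ 𝒜 i ⊨ atom φ [ x ]) ⇔ (𝒜 i ⊨ φ₀ [ x ++ y ])) →
    ∀ {a : Tuple (∏ 𝒜) n} d → (∏ 𝒜 ⊨ φ₀ [ a ++ proj₁ d ]) ⇔ ⟪ bit d ⟫ ⊆ K 𝒜 (atom φ) a
  ⊆K-represented φ φ₀ φ₀-pp iff {a} d = mk⇔
      (λ h {i} (llift t) → [ (λ z → contradiction (subst T z t) id) , id ] (to (at i) (h i)))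
      (λ h i → from (at i) (split (bit d i) λ t → h (llift t)))
    ⇔-∘ ⊨-∏-pp 𝒜 φ₀ φ₀-pp
    where
    at : ∀ i → i ∈ K 𝒜 φ₀ (a ++ proj₁ d) ⇔ (bit d i ≡ false ⊎ i ∈ K 𝒜 (atom φ) a)
    at i = (⇔-sym (I.0-iff i (dom d i)) ⊎-⇔ ⇔-id _)
      ⇔-∘ (⇔-sym (iff i _ _) ⇔-∘ Satisfaction.⊨-cong (𝒜 i) (coord-++ 𝒜 a (proj₁ d) i) φ₀)
    split : ∀ x {P : Set ℓ} → (T x → P) → x ≡ false ⊎ P
    split false h = inj₁ refl
    split true  h = inj₂ (h _)

A⇒B : {L : Language o} {Λ : Set ℓ} (𝒜 : Λ → Structure L ℓ) → ExcludedMiddle ℓ →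
      ConditionA 𝒜 → ConditionB 𝒜
A⇒B 𝒜 em (k , Θ , Θ-pp , I , atomic) = k , Θ , J , λ n φ →
  let (φ₀ , φ₀-pp , iff) = atomic n φ
      (Υ , correct) = represents-greatest em J φ₀
      ⊆K = ⊆K-represented 𝒜 em Θ-pp I φ φ₀ φ₀-pp iff in
  Υ , λ a → correct (λ d → to (⊆K d)) (λ d e → from (⊆K d) (proj₁ (lower e)))
  where J = power-interpretation 𝒜 em Θ-pp I

-- From (B) to (C): induction on formulae

module _ {L : Language o} {Λ : Set ℓ} (𝒜 : Λ → Structure L ℓ) where

  K-∷ : (φ : Formula L (suc n)) (x : Carrier (∏ 𝒜)) (a : Tuple (∏ 𝒜) n) (i : Λ) →
        i ∈ K 𝒜 φ (x ∷ᵛ a) ⇔ (𝒜 i ⊨ φ [ x i ∷ᵛ coord 𝒜 a i ])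
  K-∷ φ x a i = Satisfaction.⊨-cong (𝒜 i) (coord-∷ 𝒜 x a i) φ

  K-∃-attained : ExcludedMiddle ℓ → (φ : Formula L (suc n)) (a : Tuple (∏ 𝒜) n) →
                 ∃ λ x → K 𝒜 (∃′ φ) a ⊆ K 𝒜 φ (x ∷ᵛ a)
  K-∃-attained em φ a = x , λ {i} h → from (K-∷ φ x a i) (x-witness i h)
    where
    x : Carrier (∏ 𝒜)
    x i with em {P = i ∈ K 𝒜 (∃′ φ) a}
    ... | yes (y , _) = y
    -- Outside `K 𝒜 (∃′ φ) a` nothing is demanded of `x`; nonemptiness supplies a default.
    ... | no  _       = Structure.inhabitant (𝒜 i)
    x-witness : ∀ i → i ∈ K 𝒜 (∃′ φ) a → 𝒜 i ⊨ φ [ x i ∷ᵛ coord 𝒜 a i ]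
    x-witness i h with em {P = i ∈ K 𝒜 (∃′ φ) a}
    ... | yes (_ , h′) = h′
    ... | no  ¬h       = contradiction h ¬h

  module _ (em : ExcludedMiddle ℓ) {k} {Θ : InterpretingFormulae L k}
           (I : Interpretation Θ (𝒫 Λ) (∏ 𝒜)) where
    open Interpretation I
    open Translation I
    open Structure (𝒫 Λ) using (≈-equivalence)
    open Satisfaction (∏ 𝒜)
    private module ≈ᴮ = IsEquivalence ≈-equivalence

    -- `∃′ Υ` holds of the codes of the sets `K 𝒜 φ (x ∷ᵛ a)`. All of them lie in `K 𝒜 (∃′ φ) a`,
    -- and by `K-∃-attained` this set is one of them, hence the greatest.
    represented-∃ : {φ : Formula L (suc n)} → Represented 𝒜 I φ → Represented 𝒜 I (∃′ φ)
    represented-∃ {n} {φ} (Υ , rep) = let (Ψ , correct) = represents-greatest em I (∃′ Υ) in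
      Ψ , λ a → correct
        (λ { d (x , h) {i} i∈Fd → x i , to (K-∷ φ x a i)
          (proj₁ (lower (to (rep (x ∷ᵛ a) d) (to (shift x a d) h))) i∈Fd) })
        (λ d e → let (x , K⊆) = K-∃-attained em φ a in
          x , from (shift x a d) (from (rep (x ∷ᵛ a) d) (llift
            ((λ i∈Fd → K⊆ (proj₁ (lower e) i∈Fd)) ,
             (λ {i} h → proj₂ (lower e) (x i , to (K-∷ φ x a i) h))))))
      where
      shift : ∀ x a (d : Dom) →
              (∏ 𝒜 ⊨ Υ [ x ∷ᵛ (a ++ proj₁ d) ]) ⇔ (∏ 𝒜 ⊨ Υ [ (x ∷ᵛ a) ++ proj₁ d ])
      shift x a d = ⊨-cong (head-∷-tail-++ (x ∷ᵛ a) (proj₁ d)) Υ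

    represented : (∀ n (α : Atomic L n) → Represented 𝒜 I (atom α)) →
                  (φ : Formula L n) → Represented 𝒜 I φ
    represented atomic = classical-induction em (Represented 𝒜 I)
      (λ e (Υ , rep) → Υ , λ a d → let K≈K i = e (𝒜 i) (coord 𝒜 a i) in
        mk⇔ (λ h → ≈ᴮ.trans h (llift ((λ {i} → to (K≈K i)) , λ {i} → from (K≈K i))))
            (λ h → ≈ᴮ.trans h (llift ((λ {i} → from (K≈K i)) , λ {i} → to (K≈K i))))
        ⇔-∘ rep a d)
      (λ {n} → atomic n)
      -- `K` carries `⊤′`, `¬′` and `∧′` definitionally to the operations `1ˢ`, `Cˢ` and `△ˢ` of
      -- `𝒫 Λ`.
      (let (Ψ , correct) = represents-fun 1ˢ (λ ()) in Ψ , λ a → correct {X = λ ()} λ ())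
      (λ (Υ , rep) → let (Ψ , correct) = represents-fun Cˢ (λ _ → Υ) in
        Ψ , λ a → correct λ _ → rep a)
      (λ {_} {φ} {ψ} (Υ , rep) (Υ′ , rep′) →
        let (Ψ , correct) = represents-fun △ˢ (Υ ∷ᵛ Υ′ ∷ᵛ []ᵛ) in
        Ψ , λ a → correct {X = K 𝒜 φ a ∷ᵛ K 𝒜 ψ a ∷ᵛ []ᵛ} λ { zero → rep a ; (suc zero) → rep′ a })
      (λ {_} {φ} → represented-∃ {φ = φ})

B⇒C : {L : Language o} {Λ : Set ℓ} (𝒜 : Λ → Structure L ℓ) → ExcludedMiddle ℓ →
      ConditionB 𝒜 → ConditionC 𝒜
B⇒C 𝒜 em (k , Θ , I , atomic) = k , Θ , I , λ n φ → represented 𝒜 em I atomic φ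

C⇒B : {L : Language o} {Λ : Set ℓ} (𝒜 : Λ → Structure L ℓ) → ConditionC 𝒜 → ConditionB 𝒜
C⇒B 𝒜 (k , Θ , I , rep) = k , Θ , I , λ n φ → rep n (atom φ)

-- From (C) to definability of the full generalized product

C⇒𝒬-definable : {L : Language o} {Λ : Set ℓ} (𝒜 : Λ → Structure L ℓ) → ExcludedMiddle (lsuc ℓ) →
                ConditionC 𝒜 → FullGeneralizedProductDefinable 𝒜
C⇒𝒬-definable 𝒜 em (k , Θ , I , rep) n ξ =
  let (ψ , correct) = Translation.translatable I em Φ n (λ i → proj₁ (rep n (θ i))) in
  ψ , (λ {a} → from (correct λ i → proj₂ (rep n (θ i)) a)) ,
      (λ {a} → to (correct λ i → proj₂ (rep n (θ i)) a))
  where open AcceptableSequence ξ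

-- The Feferman-Vaught theorem for direct products

module FefermanVaught {L : Language o} {Λ : Set ℓ} (em : ExcludedMiddle ℓ)
                      (𝒜 : Λ → Structure L ℓ) where
  open Satisfaction (𝒫 Λ)

  Ks : Vector (Formula L n) m → Tuple (∏ 𝒜) n → Tuple (𝒫 Λ) m
  Ks θ a j = K 𝒜 (θ j) a

  -- An acceptable sequence with additional free set variables `Y`; for `m = 0` it is an ordinary
  -- one. The variables serve `reducible-∃`, where sets are guessed and then quantified away.
  Expressible : (Tuple (𝒫 Λ) m → Tuple (∏ 𝒜) n → Set s) → Set (o ⊔ lsuc ℓ ⊔ s)
  Expressible {m} {n} S =
    ∃[ p ] Σ[ θ ∈ Vector (Formula L n) p ] Σ[ Φ ∈ Formula LBool (m + p) ]
      ∀ Y a → S Y a ⇔ (𝒫 Λ ⊨ Φ [ Y ++ Ks θ a ])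

  private
    variable
      S : Tuple (𝒫 Λ) m → Tuple (∏ 𝒜) n → Set s
      R : Tuple (𝒫 Λ) m → Tuple (∏ 𝒜) n → Set r

  expressible-resp : (∀ Y a → R Y a ⇔ S Y a) → Expressible S → Expressible R
  expressible-resp e (p , θ , Φ , c) = p , θ , Φ , λ Y a → c Y a ⇔-∘ e Y a

  expressible-¬ : Expressible S → Expressible (λ Y a → ¬ S Y a)
  expressible-¬ (p , θ , Φ , c) = p , θ , ¬′ Φ , λ Y a → ¬-cong-⇔ (c Y a)

  expressible-× : Expressible R → Expressible S → Expressible (λ Y a → R Y a × S Y a)
  expressible-× {m} {n} (p , θ , Φ , c) (q , θ′ , Φ′ , c′) =
    p + q , θ ++ θ′ , rename v Φ ∧′ rename v′ Φ′ , λ Y a →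
      (⇔-sym (⊨-rename v (reads Y a) Φ) ⇔-∘ c Y a) ×-⇔
      (⇔-sym (⊨-rename v′ (reads′ Y a) Φ′) ⇔-∘ c′ Y a)
    where
    vY : Fin m → Fin (m + (p + q))
    vY = _↑ˡ (p + q)
    vθ : Fin p → Fin (m + (p + q))
    vθ j = m ↑ʳ (j ↑ˡ q)
    vθ′ : Fin q → Fin (m + (p + q))
    vθ′ j = m ↑ʳ (p ↑ʳ j)
    v  = vY ++ vθ
    v′ = vY ++ vθ′

    reads : ∀ Y a → (Y ++ Ks (θ ++ θ′) a) ∘ v ≋ Y ++ Ks θ a
    reads Y a = ++-reads (Y ++ Ks (θ ++ θ′) a) vY vθ
      (↑ˡ-reads Y (Ks (θ ++ θ′) a))
      (↑ʳ∘-reads Y (Ks (θ ++ θ′) a) (_↑ˡ q)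
        (λ j → ≈.reflexive (cong (λ φ → K 𝒜 φ a) (lookup-++ˡ θ θ′ j))))

    reads′ : ∀ Y a → (Y ++ Ks (θ ++ θ′) a) ∘ v′ ≋ Y ++ Ks θ′ a
    reads′ Y a = ++-reads (Y ++ Ks (θ ++ θ′) a) vY vθ′
      (↑ˡ-reads Y (Ks (θ ++ θ′) a))
      (↑ʳ∘-reads Y (Ks (θ ++ θ′) a) (p ↑ʳ_)
        (λ j → ≈.reflexive (cong (λ φ → K 𝒜 φ a) (lookup-++ʳ θ θ′ j))))

  expressible-∃ : {S : Tuple (𝒫 Λ) m → Tuple (∏ 𝒜) n → Set s} → Expressible S →
                  Expressible {0} λ _ a → ∃ λ Y → S Y a
  expressible-∃ {m} (p , θ , Φ , c) = p , θ , ∃⋆ m Φ , λ _ a →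
    ⇔-sym (⊨-∃⋆ m Φ) ⇔-∘ ∃-cong-⇔ (λ Y → c Y a)

  expressible-Boolean : (Φ : Formula LBool m) → Expressible {m} {n} λ Y _ → 𝒫 Λ ⊨ Φ [ Y ]
  expressible-Boolean Φ = 0 , (λ ()) , rename (_↑ˡ 0) Φ , λ Y a →
    ⇔-sym (⊨-rename (_↑ˡ 0) (↑ˡ-reads Y (Ks (λ ()) a)) Φ)

  expressible-⊆K : (Z : Term LBool m) (φ : Formula L n) →
                   Expressible λ Y a → eval (𝒫 Λ) Y Z ⊆ K 𝒜 φ a
  expressible-⊆K {m} Z φ = 1 , (λ _ → φ) , Z⊆ , correct
    where
    Z′ = renameᵗ (_↑ˡ 1) Z
    Z⊆ = atom (app △ˢ (Z′ ∷ᵛ var (m ↑ʳ zero) ∷ᵛ []ᵛ) ≐′ Z′)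
    correct : ∀ Y a → (eval (𝒫 Λ) Y Z ⊆ K 𝒜 φ a) ⇔ (𝒫 Λ ⊨ Z⊆ [ Y ++ Ks (λ _ → φ) a ])
    correct Y a = mk⇔ to′ from′
      where
      Z≈ = eval-renameᵗ (_↑ˡ 1) (↑ˡ-reads Y (Ks (λ _ → φ) a)) Z
      K≈ = ↑ʳ-reads Y (Ks (λ _ → φ) a) zero
      to′ : eval (𝒫 Λ) Y Z ⊆ K 𝒜 φ a → 𝒫 Λ ⊨ Z⊆ [ Y ++ Ks (λ _ → φ) a ]
      to′ h = llift (proj₁ , λ z → z , proj₂ (lower K≈) (h (proj₁ (lower Z≈) z)))
      from′ : 𝒫 Λ ⊨ Z⊆ [ Y ++ Ks (λ _ → φ) a ] → eval (𝒫 Λ) Y Z ⊆ K 𝒜 φ a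
      from′ h z = proj₁ (lower K≈) (proj₂ (proj₂ (lower h) (proj₂ (lower Z≈) z)))

  -- `χ` accumulates the conditions absorbed during the recursion of `expressible-⊆Fibre`. With
  -- `χ = ⊤′` and `y = var`, the fibre is all of `Λ` iff the sets `Y j` are the `K 𝒜 (θ j) (x ∷ᵛ a)`
  -- of a single `x`. Unfolding the recursion gives one inclusion for each sign pattern of the
  -- `θ j`.
  Fibre : ∀ {r} → Formula L (suc n) → Vector (Formula L (suc n)) r → Vector (Term LBool m) r →
          Tuple (𝒫 Λ) m → Tuple (∏ 𝒜) n → Pred Λ ℓ
  Fibre χ θ y Y a i = ∃ λ x → (𝒜 i ⊨ χ [ x ∷ᵛ coord 𝒜 a i ]) ×
    (∀ j → i ∈ eval (𝒫 Λ) Y (y j) ⇔ (𝒜 i ⊨ θ j [ x ∷ᵛ coord 𝒜 a i ]))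

  -- Case distinction on membership in y₀ splits Z into two pieces, on each of
  -- which the condition on θ₀ can be absorbed into χ.
  expressible-⊆Fibre : ∀ {r} (χ : Formula L (suc n)) (θ : Vector (Formula L (suc n)) r)
    (y : Vector (Term LBool m) r) (Z : Term LBool m) →
    Expressible λ Y a → eval (𝒫 Λ) Y Z ⊆ Fibre χ θ y Y a
  expressible-⊆Fibre {r = zero} χ θ y Z =
    expressible-resp (λ Y a → mk⇔ (to′ Y a) (from′ Y a)) (expressible-⊆K Z (∃′ χ))
    where
    to′ : ∀ Y a → eval (𝒫 Λ) Y Z ⊆ Fibre χ θ y Y a → eval (𝒫 Λ) Y Z ⊆ K 𝒜 (∃′ χ) a
    to′ Y a h z = let (x , hx , _) = h z in x , hx
    from′ : ∀ Y a → eval (𝒫 Λ) Y Z ⊆ K 𝒜 (∃′ χ) a → eval (𝒫 Λ) Y Z ⊆ Fibre χ θ y Y a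
    from′ Y a h z = let (x , hx) = h z in x , hx , λ ()
  expressible-⊆Fibre {n} {m} {suc r} χ θ y Z =
    expressible-resp (λ Y a → mk⇔ (to′ Y a) (from′ Y a)) (expressible-×
      (expressible-⊆Fibre (χ ∧′ θ zero) (θ ∘ suc) (y ∘ suc) Z⁺)
      (expressible-⊆Fibre (χ ∧′ ¬′ θ zero) (θ ∘ suc) (y ∘ suc) Z⁻))
    where
    Z⁺ Z⁻ : Term LBool m
    Z⁺ = app △ˢ (Z ∷ᵛ y zero ∷ᵛ []ᵛ)
    Z⁻ = app △ˢ (Z ∷ᵛ app Cˢ (λ _ → y zero) ∷ᵛ []ᵛ)
    Split : Tuple (𝒫 Λ) m → Tuple (∏ 𝒜) n → Set ℓ
    Split Y a = eval (𝒫 Λ) Y Z⁺ ⊆ Fibre (χ ∧′ θ zero) (θ ∘ suc) (y ∘ suc) Y a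
              × eval (𝒫 Λ) Y Z⁻ ⊆ Fibre (χ ∧′ ¬′ θ zero) (θ ∘ suc) (y ∘ suc) Y a

    to′ : ∀ Y a → eval (𝒫 Λ) Y Z ⊆ Fibre χ θ y Y a → Split Y a
    to′ Y a h =
      (λ (z , y∋i) → let (x , hx , e) = h z in x , (hx , to (e zero) y∋i) , e ∘ suc) ,
      (λ (z , y∌i) → let (x , hx , e) = h z in x , (hx , y∌i ∘ from (e zero)) , e ∘ suc)
    from′ : ∀ Y a → Split Y a → eval (𝒫 Λ) Y Z ⊆ Fibre χ θ y Y a
    from′ Y a (h⁺ , h⁻) {i} z with em {P = i ∈ eval (𝒫 Λ) Y (y zero)}
    ... | yes y∋i = let (x , (hx , t) , e) = h⁺ (z , y∋i) in
      x , hx , λ { zero → mk⇔ (λ _ → t) (λ _ → y∋i) ; (suc j) → e j }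
    ... | no  y∌i = let (x , (hx , ¬t) , e) = h⁻ (z , y∌i) in
      x , hx , λ { zero → mk⇔ (λ y∋i → contradiction y∋i y∌i) (λ t → contradiction t ¬t)
                 ; (suc j) → e j }

  Reducible : Formula L n → Set (o ⊔ lsuc ℓ)
  Reducible φ = Expressible {0} λ _ a → ∏ 𝒜 ⊨ φ [ a ]

  -- Truth of an atom in a product is truth in every coordinate, which the Boolean equation `K = 1`
  -- expresses.
  reducible-atom : (α : Atomic L n) → Reducible (atom α)
  reducible-atom α = 1 , (λ _ → atom α) , atom (var zero ≐′ app 1ˢ []ᵛ) , λ _ a →
    mk⇔ (λ h → llift (_ , λ {i} _ → h i)) (λ h i → proj₂ (lower h) _) ⇔-∘ ⊨-∏-atom 𝒜 α

  -- The sets Y j play the role of K (θ j) (x ∷ a) for the x sought; that x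
  -- is assembled from witnesses chosen in every coordinate.
  reducible-∃ : {φ : Formula L (suc n)} → Reducible φ → Reducible (∃′ φ)
  reducible-∃ {n} {φ} (p , θ , Φ , c) = expressible-resp (λ _ a → mk⇔ (to′ a) (from′ a))
    (expressible-∃ (expressible-× (expressible-Boolean Φ)
      (expressible-⊆Fibre ⊤′ θ var (app 1ˢ []ᵛ))))
    where
    Guess : Tuple (∏ 𝒜) n → Set (lsuc ℓ)
    Guess a = ∃ λ Y → (𝒫 Λ ⊨ Φ [ Y ]) × eval (𝒫 Λ) Y (app 1ˢ []ᵛ) ⊆ Fibre ⊤′ θ var Y a

    to′ : ∀ a → ∏ 𝒜 ⊨ ∃′ φ [ a ] → Guess a
    to′ a (x , h) = Ks θ (x ∷ᵛ a) , to (c []ᵛ (x ∷ᵛ a)) h ,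
      λ {i} _ → x i , _ , λ j → K-∷ 𝒜 (θ j) x a i

    from′ : ∀ a → Guess a → ∏ 𝒜 ⊨ ∃′ φ [ a ]
    from′ a (Y , h , f) = x , from (c []ᵛ (x ∷ᵛ a)) (to (⊨-cong Y≋K Φ) h)
      where
      x : Carrier (∏ 𝒜)
      x i = proj₁ (f {i} _)
      Y⇔K : ∀ j i → i ∈ Y j ⇔ i ∈ K 𝒜 (θ j) (x ∷ᵛ a)
      Y⇔K j i = ⇔-sym (K-∷ 𝒜 (θ j) x a i) ⇔-∘ proj₂ (proj₂ (f {i} _)) j
      Y≋K : Y ≋ Ks θ (x ∷ᵛ a)
      Y≋K j = llift ((λ {i} → to (Y⇔K j i)) , λ {i} → from (Y⇔K j i))

  reducible : (φ : Formula L n) → Reducible φ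
  reducible = classical-induction em Reducible
    (λ e → expressible-resp λ _ a → ⇔-sym (e (∏ 𝒜) a))
    reducible-atom
    (0 , (λ ()) , ⊤′ , λ _ _ → mk⇔ _ _)
    expressible-¬
    expressible-×
    (λ {_} {φ} → reducible-∃ {φ = φ})

  definable⇒𝒬 : {S : Pred (Tuple (∏ 𝒜) n) s} → Definable (∏ 𝒜) S → ∃ λ ξ → S ≐ 𝒬 𝒜 ξ
  definable⇒𝒬 (ψ , S⊆ , ⊆S) = let (p , θ , Φ , c) = reducible ψ in
    record { m = p ; Φ = Φ ; θ = θ } ,
    (λ {a} h → to (c []ᵛ a) (S⊆ h)) , (λ {a} h → ⊆S (from (c []ᵛ a) h))

-- Satisfaction in the `𝒜 i` and in `∏ 𝒜` lives at level `ℓ`, in `𝒫 Λ` at `lsuc ℓ`. Excluded middle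
-- at the higher level covers both.
lower-em : ExcludedMiddle (lsuc ℓ) → ExcludedMiddle ℓ
lower-em em = map′ lower llift em

-- From (C) to (D), and assembly of the implications

C⇒D : {L : Language o} {Λ : Set ℓ} (𝒜 : Λ → Structure L ℓ) → ExcludedMiddle (lsuc ℓ) →
      ConditionC 𝒜 → ConditionD 𝒜
C⇒D 𝒜 em c = 𝒬-definable , λ n S → mk⇔ definable⇒𝒬
  λ (ξ , S⊆ , ⊆S) → let (ψ , 𝒬⊆ , ⊆𝒬) = 𝒬-definable n ξ in
    ψ , (λ {a} h → 𝒬⊆ (S⊆ h)) , λ {a} h → ⊆S (⊆𝒬 h)
  where
  open FefermanVaught (lower-em em) 𝒜
  𝒬-definable = C⇒𝒬-definable 𝒜 em c

theorem3p6 : ∀ {o ℓ} → ExcludedMiddle (lsuc ℓ) →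
    (L : Language o) (Λ : Set ℓ) (𝒜 : Λ → Structure L ℓ) →
    (ConditionA 𝒜 → ConditionB 𝒜)
    × (ConditionB 𝒜 ⇔ ConditionC 𝒜)
    × (ConditionC 𝒜 → ConditionD 𝒜)
theorem3p6 em L Λ 𝒜 =
  A⇒B 𝒜 (lower-em em) , mk⇔ (B⇒C 𝒜 (lower-em em)) (C⇒B 𝒜) , C⇒D 𝒜 em
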